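{- Let $M(n)$ be the number of simply paired partitions of $n$ having negative pairing rank, and let $\overline p_{\mathrm{odd}}(n)$ be the number of overpartitions of $n$ into odd parts. Then, for every $n\geq 1$, $$M(n)=\frac12\,\overline p_{\mathrm{odd}}(n).$$
   Context: A partition is simply paired if no part occurs more than three times. For a partition $\lambda$, let $r(\lambda)$ be the largest part size of multiplicity at least $2$ ($r(\lambda)=0$ if $\lambda$ has distinct parts). Let $u_1>u_2>\cdots$ be the part sizes occurring with odd multiplicity, each taken once, and let $s(\lambda)=u_1-u_2+u_3-u_4+\cdots$ ($0$ if there are none). The pairing rank is $\rho(\lambda)=r(\lambda)-s(\lambda)$. An overpartition is a partition in which the first occurrence of each distinct part may be overlined. -}

module Defs where

open import Data.Bool using (Bool; true; false)
import Data.Bool.Properties as Bool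
open import Data.Integer using (ℤ; +_; 0ℤ)
import Data.Integer as ℤ
open import Data.List using (List; []; _∷_; map; length; filter; deduplicate; upTo; cartesianProduct; cartesianProductWith)
open import Data.List.Extrema.Nat using (max)
open import Data.List.Membership.Propositional using (_∈_)
open import Data.List.Membership.Propositional.Properties
  using (∈-filter⁺; ∈-filter⁻; ∈-upTo⁺; ∈-cartesianProduct⁺; ∈-cartesianProductWith⁺; ∈-cartesianProductWith⁻)
open import Data.List.Properties using (∷-injective; map-id)
open import Data.List.Relation.Unary.All using (All; []; _∷_; all?)
import Data.List.Relation.Unary.All as All
import Data.List.Relation.Unary.All.Properties as All
open import Data.List.Relation.Unary.AllPairs using ([]; _∷_)
open import Data.List.Relation.Unary.Any using (here; there)
open import Data.List.Relation.Unary.Linked using (Linked; linked?)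
open import Data.List.Relation.Unary.Unique.Propositional using (Unique)
import Data.List.Relation.Unary.Unique.Propositional.Properties as Unique
open import Data.Nat using (ℕ; zero; suc; _+_; _≤_; _<_; _>_; _≥_; _≟_; _≤?_; _<?_; _≥?_; _%_; s≤s; z≤n)
open import Data.Nat.ListAction using (sum)
open import Data.Nat.Properties using (≤-trans; +-mono-≤; m≤m+n; m≤n+m)
open import Data.Product using (_×_; _,_; proj₁; proj₂)
open import Data.Sum using (_⊎_)
open import Function using (_∘_)
open import Function.Bundles using (_⇔_; mk⇔)
open import Relation.Binary.PropositionalEquality using (_≡_; refl; subst; sym)
open import Relation.Nullary.Decidable using (Dec; _×-dec_; _⊎-dec_)
open import Relation.Unary using (Decidable)

-- The length of `elements` depends only on P (up to logical equivalence),
-- not on the enumeration chosen.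
record Finite {A : Set} (P : A → Set) : Set where
  field
    elements : List A
    unique   : Unique elements
    complete : ∀ x → x ∈ elements ⇔ P x

  card : ℕ
  card = length elements

finite : ∀ {A : Set} {P : A → Set} → Decidable P → (xs : List A) → Unique xs →
         (∀ {x} → P x → x ∈ xs) → Finite P
finite P? xs uniq P⊆xs = record
  { elements = filter P? xs
  ; unique   = Unique.filter⁺ P? uniq
  ; complete = λ x → mk⇔ (proj₂ ∘ ∈-filter⁻ P? {xs = xs}) (λ px → ∈-filter⁺ P? (P⊆xs px) px)
  }

Odd : ℕ → Set
Odd n = n % 2 ≡ 1

odd? : Decidable Odd
odd? n = n % 2 ≟ 1

IsPartition : ℕ → List ℕ → Set
IsPartition n xs = All (0 <_) xs × Linked _≥_ xs × sum xs ≡ n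

isPartition? : ∀ n → Decidable (IsPartition n)
isPartition? n xs = all? (0 <?_) xs ×-dec linked? _≥?_ xs ×-dec sum xs ≟ n

multiplicity : ℕ → List ℕ → ℕ
multiplicity k xs = length (filter (k ≟_) xs)

SimplyPaired : List ℕ → Set
SimplyPaired xs = All (λ k → multiplicity k xs ≤ 3) xs

simplyPaired? : Decidable SimplyPaired
simplyPaired? xs = all? (λ k → multiplicity k xs ≤? 3) xs

r : List ℕ → ℕ
r xs = max 0 (filter (λ k → 2 ≤? multiplicity k xs) xs)

-- On a weakly decreasing list this is strictly decreasing: u₁ > u₂ > ⋯.
oddSizes : List ℕ → List ℕ
oddSizes xs = deduplicate _≟_ (filter (λ k → odd? (multiplicity k xs)) xs)

alternatingSum : List ℕ → ℤ
alternatingSum []       = 0ℤ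
alternatingSum (u ∷ us) = + u ℤ.- alternatingSum us

s : List ℕ → ℤ
s xs = alternatingSum (oddSizes xs)

ρ : List ℕ → ℤ
ρ xs = + r xs ℤ.- s xs

-- true = overlined
OverPart : Set
OverPart = ℕ × Bool

size : OverPart → ℕ
size = proj₁

-- Relation between consecutive parts: the sizes weakly decrease, and a part
-- which is not the first occurrence of its size is not overlined.
_⊵_ : OverPart → OverPart → Set
(a , _) ⊵ (b , o) = a > b ⊎ (a ≡ b × o ≡ false)

_⊵?_ : ∀ p q → Dec (p ⊵ q)
(a , _) ⊵? (b , o) = (b <? a) ⊎-dec ((a ≟ b) ×-dec (o Bool.≟ false))

IsOverpartition : ℕ → List OverPart → Set
IsOverpartition n ps = All (0 <_) (map size ps) × Linked _⊵_ ps × sum (map size ps) ≡ n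

isOverpartition? : ∀ n → Decidable (IsOverpartition n)
isOverpartition? n ps =
  all? (0 <?_) (map size ps) ×-dec linked? _⊵?_ ps ×-dec sum (map size ps) ≟ n

words : ∀ {A : Set} → List A → ℕ → List (List A)
words as zero    = [] ∷ []
words as (suc l) = [] ∷ cartesianProductWith _∷_ as (words as l)

words-unique : ∀ {A : Set} {as : List A} → Unique as → ∀ l → Unique (words as l)
words-unique u zero    = [] ∷ []
words-unique {as = as} u (suc l) =
  All.tabulate nonempty ∷ Unique.cartesianProductWith⁺ _∷_ ∷-injective u (words-unique u l)
  where
  nonempty : ∀ {w} → w ∈ cartesianProductWith _∷_ as (words as l) → _≡_ [] w → _
  nonempty w∈ refl with () ← proj₂ (proj₂ (proj₂ (proj₂ (∈-cartesianProductWith⁻ _∷_ as (words as l) w∈))))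

words-complete : ∀ {A : Set} {as xs : List A} l → length xs ≤ l → All (_∈ as) xs → xs ∈ words as l
words-complete zero    z≤n     []         = here refl
words-complete (suc l) z≤n     []         = here refl
words-complete (suc l) (s≤s p) (x∈ ∷ xs∈) =
  there (∈-cartesianProductWith⁺ _∷_ x∈ (words-complete l p xs∈))

module _ {A : Set} (w : A → ℕ) where

  length≤sum : ∀ {xs} → All (0 <_) (map w xs) → length xs ≤ sum (map w xs)
  length≤sum {[]}     []       = z≤n
  length≤sum {x ∷ xs} (p ∷ ps) = +-mono-≤ p (length≤sum ps)

  parts≤sum : ∀ xs → All (λ x → w x ≤ sum (map w xs)) xs
  parts≤sum []       = []
  parts≤sum (x ∷ xs) =
    m≤m+n (w x) _ ∷ All.map (λ p → ≤-trans p (m≤n+m _ (w x))) (parts≤sum xs)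

  bounded : ∀ {as : List A} {n xs} → (∀ {x} → w x ≤ n → x ∈ as) →
            All (0 <_) (map w xs) → sum (map w xs) ≡ n → xs ∈ words as n
  bounded {xs = xs} as-complete pos refl =
    words-complete _ (length≤sum pos) (All.map as-complete (parts≤sum xs))

overParts : ℕ → List OverPart
overParts n = cartesianProduct (upTo (suc n)) (false ∷ true ∷ [])

overParts-unique : ∀ n → Unique (overParts n)
overParts-unique n = Unique.cartesianProduct⁺ (Unique.upTo⁺ (suc n)) (((λ ()) ∷ []) ∷ [] ∷ [])

overParts-complete : ∀ {n p} → size p ≤ n → p ∈ overParts n
overParts-complete {p = _ , false} k≤n = ∈-cartesianProduct⁺ (∈-upTo⁺ (s≤s k≤n)) (here refl)
overParts-complete {p = _ , true}  k≤n = ∈-cartesianProduct⁺ (∈-upTo⁺ (s≤s k≤n)) (there (here refl))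

IsNegativeSimplyPaired : ℕ → List ℕ → Set
IsNegativeSimplyPaired n xs = IsPartition n xs × SimplyPaired xs × ρ xs ℤ.< 0ℤ

negativeSimplyPaired : ∀ n → Finite (IsNegativeSimplyPaired n)
negativeSimplyPaired n = finite
  (λ xs → isPartition? n xs ×-dec simplyPaired? xs ×-dec ρ xs ℤ.<? 0ℤ)
  (words (upTo (suc n)) n)
  (words-unique (Unique.upTo⁺ (suc n)) n)
  λ {xs} ((pos , _ , total) , _) → bounded (λ k → k) (∈-upTo⁺ ∘ s≤s)
    (subst (All (0 <_)) (sym (map-id xs)) pos)
    (subst (λ ys → sum ys ≡ n) (sym (map-id xs)) total)

IsOddOverpartition : ℕ → List OverPart → Set
IsOddOverpartition n ps = IsOverpartition n ps × All Odd (map size ps)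

oddOverpartitions : ∀ n → Finite (IsOddOverpartition n)
oddOverpartitions n = finite
  (λ ps → isOverpartition? n ps ×-dec all? odd? (map size ps))
  (words (overParts n) n)
  (words-unique (overParts-unique n) n)
  (λ ((pos , _ , total) , _) → bounded size overParts-complete pos total)

M : ℕ → ℕ
M n = Finite.card (negativeSimplyPaired n)

p̄odd : ℕ → ℕ
p̄odd n = Finite.card (oddOverpartitions n)

{-# OPTIONS --safe #-}
-- A simply paired partition splits into the set D of its sizes of odd
-- multiplicity and the set P of its sizes of multiplicity at least 2, with total
-- ΣD + 2 ΣP, s = alt D and r = max P.  Removing the largest element of D ⊆ {1, …, L + 1}
-- turns alternating sum k into L + 1 − k, so the generating functions d L k satisfy
--   d (L + 1) k = d L k + q^(L + 1) d L (L + 1 − k),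
-- whose solution is qᵏ times a Gaussian binomial in q²; the Pascal rules give, as
-- L → ∞, qᵏ / ((1 − q²)(1 − q⁴)⋯(1 − q²ᵏ)).  The sets P with max P < k contribute
-- (1 + q²)⋯(1 + q²ᵏ⁻²), and twice the product satisfies the recurrence in k of the
-- odd overpartitions with k parts, which is read off the last part.
module Submission where

open import Defs
open import Data.Bool using (Bool; true; false; if_then_else_)
import Data.Integer as ℤ
import Data.Integer.Properties as ℤ
open import Data.List using (List; []; _∷_; _++_; _∷ʳ_; map; length; filter; replicate; deduplicate; cartesianProduct; cartesianProductWith; initLast; _∷ʳ′_)
open import Data.List.Extrema.Nat using (max; max≈v⁺)
open import Data.List.Membership.Propositional using (_∈_)
open import Data.List.Membership.Propositional.Properties
  using (∈-map⁺; ∈-map⁻; ∈-++⁺ˡ; ∈-++⁺ʳ; ∈-++⁻; ∈-filter⁺; ∈-filter⁻; ∈-cartesianProductWith⁺; ∈-cartesianProduct⁺)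
open import Data.List.Membership.Propositional.Properties.WithK using (unique∧set⇒bag)
open import Data.List.Properties
  using (length-++; length-map; length-replicate; map-++; map-id; map-injective; filter-++; filter-all; filter-none; filter-reject; ∷-injectiveʳ; ∷ʳ-injectiveˡ; ∷ʳ-injectiveʳ)
open import Data.List.Relation.Binary.BagAndSetEquality using (∼bag⇒↭)
open import Data.List.Relation.Binary.Permutation.Propositional.Properties using (↭-length)
open import Data.List.Relation.Unary.All as All using (All; []; _∷_)
import Data.List.Relation.Unary.All.Properties as All
open import Data.List.Relation.Unary.AllPairs using ([]; _∷_)
open import Data.List.Relation.Unary.Any using (here; there)
open import Data.List.Relation.Unary.Linked as Linked using (Linked; []; [-]; _∷_)
import Data.List.Relation.Unary.Linked.Properties as Linked
open import Data.List.Relation.Unary.Unique.Propositional using (Unique)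
import Data.List.Relation.Unary.Unique.Propositional.Properties as Unique
open import Data.Nat
open import Data.Nat.ListAction using (sum)
open import Data.Nat.ListAction.Properties using (sum-++)
open import Data.Nat.Properties
open import Data.Nat.Tactic.RingSolver using (solve-∀)
open import Data.Product using (∃; ∃₂; _×_; _,_; proj₁; proj₂)
open import Data.Sum using (_⊎_; inj₁; inj₂; [_,_]′)
open import Data.Sum.Properties using (inj₁-injective; inj₂-injective)
open import Data.Vec using (Vec; []; _∷_)
import Data.Vec.Properties as Vec
open import Function using (_∘_; id)
open import Function.Bundles using (mk⇔; Equivalence)
open import Relation.Binary.PropositionalEquality
open import Relation.Nullary using (¬_; does; yes; no; contradiction; ¬?)
open import Relation.Nullary.Decidable using (_×-dec_; dec-true; dec-false)
open import Relation.Unary using (Decidable)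

open Finite

-- Counting finite sets through bijections and disjoint unions

∈⇒ : ∀ {A : Set} {P : A → Set} (F : Finite P) {x} → x ∈ elements F → P x
∈⇒ F = Equivalence.to (complete F _)

⇒∈ : ∀ {A : Set} {P : A → Set} (F : Finite P) {x} → P x → x ∈ elements F
⇒∈ F = Equivalence.from (complete F _)

-- The image of the enumeration of `P` and the enumeration of `Q` have no repetitions and the same
-- members, so one permutes the other.
card-bij : ∀ {A B : Set} {P : A → Set} {Q : B → Set} (F : Finite P) (G : Finite Q) (f : A → B) →
           (∀ {x y} → f x ≡ f y → x ≡ y) →
           (∀ {x} → P x → Q (f x)) →
           (∀ {y} → Q y → ∃ λ x → P x × f x ≡ y) →
           card F ≡ card G
card-bij F G f inj to from = trans (sym (length-map f (elements F)))
  (↭-length (∼bag⇒↭ (unique∧set⇒bag (Unique.map⁺ inj (unique F)) (unique G) (mk⇔ fwd bwd))))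
  where
  fwd : ∀ {y} → y ∈ map f (elements F) → y ∈ elements G
  fwd y∈ with x , x∈ , refl ← ∈-map⁻ f y∈ = ⇒∈ G (to (∈⇒ F x∈))
  bwd : ∀ {y} → y ∈ elements G → y ∈ map f (elements F)
  bwd y∈ with x , px , refl ← from (∈⇒ G y∈) = ∈-map⁺ f (⇒∈ F px)

card-cong : ∀ {A : Set} {P Q : A → Set} (F : Finite P) (G : Finite Q) →
            (∀ {x} → P x → Q x) → (∀ {x} → Q x → P x) → card F ≡ card G
card-cong F G to from = card-bij F G id id to (λ q → _ , from q , refl)

card-empty : ∀ {A : Set} {P : A → Set} (F : Finite P) → (∀ {x} → ¬ P x) → card F ≡ 0
card-empty record { elements = [] } ¬p = refl
card-empty F@record { elements = x ∷ _ } ¬p = contradiction (∈⇒ F (here refl)) ¬p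

restrict : ∀ {A : Set} {P Q : A → Set} → Finite P → Decidable Q → Finite (λ x → P x × Q x)
restrict F Q? = record
  { elements = filter Q? (elements F)
  ; unique   = Unique.filter⁺ Q? (unique F)
  ; complete = λ x → mk⇔
      (λ x∈ → let x∈F , q = ∈-filter⁻ Q? {xs = elements F} x∈ in ∈⇒ F x∈F , q)
      (λ (p , q) → ∈-filter⁺ Q? (⇒∈ F p) q)
  }

_⊎F_ : ∀ {A B : Set} {P : A → Set} {Q : B → Set} → Finite P → Finite Q → Finite [ P , Q ]′
F ⊎F G = record
  { elements = map inj₁ (elements F) ++ map inj₂ (elements G)
  ; unique   = Unique.++⁺ (Unique.map⁺ inj₁-injective (unique F)) (Unique.map⁺ inj₂-injective (unique G)) disjoint
  ; complete = λ x → mk⇔ to from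
  }
  where
  disjoint : ∀ {z} → ¬ (z ∈ map inj₁ (elements F) × z ∈ map inj₂ (elements G))
  disjoint (z∈ , z∈′) with _ , _ , refl ← ∈-map⁻ inj₁ z∈ | _ , _ , () ← ∈-map⁻ inj₂ z∈′
  to : ∀ {z} → z ∈ map inj₁ (elements F) ++ map inj₂ (elements G) → [ _ , _ ]′ z
  to z∈ with ∈-++⁻ (map inj₁ (elements F)) z∈
  ... | inj₁ i with _ , x∈ , refl ← ∈-map⁻ inj₁ i = ∈⇒ F x∈
  ... | inj₂ i with _ , x∈ , refl ← ∈-map⁻ inj₂ i = ∈⇒ G x∈
  from : ∀ {z} → [ _ , _ ]′ z → z ∈ map inj₁ (elements F) ++ map inj₂ (elements G)
  from {inj₁ x} p = ∈-++⁺ˡ (∈-map⁺ inj₁ (⇒∈ F p))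
  from {inj₂ y} q = ∈-++⁺ʳ _ (∈-map⁺ inj₂ (⇒∈ G q))

card-⊎F : ∀ {A B : Set} {P : A → Set} {Q : B → Set} (F : Finite P) (G : Finite Q) →
          card (F ⊎F G) ≡ card F + card G
card-⊎F F G = trans (length-++ (map inj₁ (elements F)))
  (cong₂ _+_ (length-map inj₁ (elements F)) (length-map inj₂ (elements G)))

-- Power series in q and their shifts

-- Coefficient sequences of power series in q; j ▹ f is q^j f.
infixr 5 _▹_
_▹_ : ℕ → (ℕ → ℕ) → ℕ → ℕ
(zero  ▹ f) n       = f n
(suc j ▹ f) zero    = 0
(suc j ▹ f) (suc n) = (j ▹ f) n

infixl 4.5 _⊕_
_⊕_ : (ℕ → ℕ) → (ℕ → ℕ) → ℕ → ℕ
(f ⊕ g) n = f n + g n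

-- The coefficient of `j ▹ f` at `n` reads `f` at most at an index up to `n`. This form serves
-- identities such as `d-stable`, which hold only for small indices.
▹-cong≤ : ∀ j {f g} n → (∀ m → m ≤ n → f m ≡ g m) → (j ▹ f) n ≡ (j ▹ g) n
▹-cong≤ zero    n       eq = eq n ≤-refl
▹-cong≤ (suc j) zero    eq = refl
▹-cong≤ (suc j) (suc n) eq = ▹-cong≤ j n (λ m m≤n → eq m (m≤n⇒m≤1+n m≤n))

▹-cong : ∀ j {f g} → f ≗ g → j ▹ f ≗ j ▹ g
▹-cong j eq n = ▹-cong≤ j n (λ m _ → eq m)

▹-⊕ : ∀ j f g → j ▹ (f ⊕ g) ≗ (j ▹ f) ⊕ (j ▹ g)
▹-⊕ zero    f g n       = refl
▹-⊕ (suc j) f g zero    = refl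
▹-⊕ (suc j) f g (suc n) = ▹-⊕ j f g n

▹-▹ : ∀ i j f → i ▹ j ▹ f ≗ (i + j) ▹ f
▹-▹ zero    j f n       = refl
▹-▹ (suc i) j f zero    = refl
▹-▹ (suc i) j f (suc n) = ▹-▹ i j f n

▹-zero : ∀ j {f} → (∀ n → f n ≡ 0) → ∀ n → (j ▹ f) n ≡ 0
▹-zero zero    eq n       = eq n
▹-zero (suc j) eq zero    = refl
▹-zero (suc j) eq (suc n) = ▹-zero j eq n

▹-small : ∀ j f {n} → n < j → (j ▹ f) n ≡ 0
▹-small (suc j) f {zero}  _         = refl
▹-small (suc j) f {suc n} (s≤s n<j) = ▹-small j f n<j

-- Since the shift is by at least one, the equation determines the coefficient at `n` from earlier
-- ones. The bound `b` makes this strong induction structural.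
▹-fixpoint-unique : ∀ j {f g h} → f ≗ suc j ▹ f ⊕ h → g ≗ suc j ▹ g ⊕ h → f ≗ g
▹-fixpoint-unique j {f} {g} {h} f-eq g-eq n = go n n ≤-refl
  where
  go : ∀ b n → n ≤ b → f n ≡ g n
  step : ∀ b n → n ≤ b → (suc j ▹ f) n ≡ (suc j ▹ g) n
  step b       zero    _         = refl
  step (suc b) (suc n) (s≤s n≤b) = ▹-cong≤ j n (λ m m≤n → go b m (≤-trans m≤n n≤b))
  go b n n≤b = trans (f-eq n) (trans (cong (_+ h n) (step b n n≤b)) (sym (g-eq n)))

-- Writing the index as `j + m` instead of subtracting makes the family empty for `n < j`, as the
-- coefficients of `j ▹ f` require.
Shifted : ∀ {A : Set} → ℕ → (ℕ → A → Set) → ℕ → A → Set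
Shifted j P n x = ∃ λ m → j + m ≡ n × P m x

shiftF : ∀ {A : Set} {P : ℕ → A → Set} j → (∀ n → Finite (P n)) → ∀ n → Finite (Shifted j P n)
shiftF zero F n = record
  { elements = elements (F n) ; unique = unique (F n)
  ; complete = λ x → mk⇔ (λ x∈ → n , refl , ∈⇒ (F n) x∈) (λ { (_ , refl , p) → ⇒∈ (F n) p })
  }
shiftF (suc j) F zero = record
  { elements = [] ; unique = [] ; complete = λ x → mk⇔ (λ ()) (λ { (_ , () , _) }) }
shiftF (suc j) F (suc n) = record
  { elements = elements (shiftF j F n) ; unique = unique (shiftF j F n)
  ; complete = λ x → mk⇔
      (λ x∈ → let m , eq , p = ∈⇒ (shiftF j F n) x∈ in m , cong suc eq , p)
      (λ (m , eq , p) → ⇒∈ (shiftF j F n) (m , suc-injective eq , p))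
  }

card-shiftF : ∀ {A : Set} {P : ℕ → A → Set} j (F : ∀ n → Finite (P n)) →
              (λ n → card (shiftF j F n)) ≗ j ▹ (λ n → card (F n))
card-shiftF zero    F n       = refl
card-shiftF (suc j) F zero    = refl
card-shiftF (suc j) F (suc n) = card-shiftF j F n

-- Subsets of {1, ..., L} as Boolean words

allWords : ∀ L → List (Vec Bool L)
allWords zero    = [] ∷ []
allWords (suc L) = cartesianProductWith _∷_ (false ∷ true ∷ []) (allWords L)

allWords-unique : ∀ L → Unique (allWords L)
allWords-unique zero    = [] ∷ []
allWords-unique (suc L) = Unique.cartesianProductWith⁺ _∷_ Vec.∷-injective
  (((λ ()) ∷ []) ∷ [] ∷ []) (allWords-unique L)

∈-allWords : ∀ {L} (w : Vec Bool L) → w ∈ allWords L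
∈-allWords []          = here refl
∈-allWords (false ∷ w) = ∈-cartesianProductWith⁺ _∷_ {xs = false ∷ true ∷ []} (here refl) (∈-allWords w)
∈-allWords (true  ∷ w) = ∈-cartesianProductWith⁺ _∷_ {xs = false ∷ true ∷ []} (there (here refl)) (∈-allWords w)

-- A word of length L encodes a subset of {1, …, L}, the first letter
-- telling whether L belongs to it.
weight : ∀ {L} → Vec Bool L → ℕ
weight []                  = 0
weight (false ∷ b)         = weight b
weight {suc L} (true ∷ b)  = suc L + weight b

alt : ∀ {L} → Vec Bool L → ℕ
alt []                 = 0
alt (false ∷ b)        = alt b
alt {suc L} (true ∷ b) = suc L ∸ alt b

top : ∀ {L} → Vec Bool L → ℕ
top []                 = 0
top (false ∷ b)        = top b
top {suc L} (true ∷ b) = suc L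

-- This makes the truncated subtraction in `alt` exact, and limits the alternating sums to be
-- considered to 0, ..., L.
alt≤ : ∀ {L} (b : Vec Bool L) → alt b ≤ L
alt≤ []                 = z≤n
alt≤ (false ∷ b)        = m≤n⇒m≤1+n (alt≤ b)
alt≤ {suc L} (true ∷ b) = m∸n≤m (suc L) (alt b)

top≤ : ∀ {L} (b : Vec Bool L) → top b ≤ L
top≤ []          = z≤n
top≤ (false ∷ b) = m≤n⇒m≤1+n (top≤ b)
top≤ (true ∷ b)  = ≤-refl

-- Subsets by alternating sum and total

distinct : ∀ L k n → Finite (λ (b : Vec Bool L) → alt b ≡ k × weight b ≡ n)
distinct L k n = finite (λ b → alt b ≟ k ×-dec weight b ≟ n) (allWords L) (allWords-unique L) (λ _ → ∈-allWords _)

d : ℕ → ℕ → ℕ → ℕ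
d L k n = card (distinct L k n)

d-large : ∀ L k → L < k → ∀ n → d L k n ≡ 0
d-large L k L<k n = card-empty (distinct L k n) λ { {b} (refl , _) → <⇒≱ L<k (alt≤ b) }

-- Removing L + 1 from a set of alternating sum k leaves one of alternating sum N.
d-rec : ∀ k N L → k + N ≡ suc L → d (suc L) k ≗ d L k ⊕ suc L ▹ d L N
d-rec k N L k+N n = sym (trans
  (trans (sym (cong (d L k n +_) (card-shiftF (suc L) (distinct L N) n))) (sym (card-⊎F (distinct L k n) (shiftF (suc L) (distinct L N) n))))
  (card-bij (distinct L k n ⊎F shiftF (suc L) (distinct L N) n) (distinct (suc L) k n)
     [ false ∷_ , true ∷_ ]′ inj (λ {x} → to x) from))
  where
  inj : ∀ {x y} → [ false ∷_ , true ∷_ ]′ x ≡ [ false ∷_ , true ∷_ ]′ y → x ≡ y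
  inj {inj₁ _} {inj₁ _} refl = refl
  inj {inj₂ _} {inj₂ _} refl = refl
  to : ∀ x → [ _ , Shifted (suc L) _ n ]′ x → _
  to (inj₁ b) p = p
  to (inj₂ b) (m , refl , refl , refl) = trans (cong (_∸ alt b) (sym k+N)) (m+n∸n≡m k (alt b)) , refl
  from : ∀ {y} → _ → ∃ λ x → [ _ , Shifted (suc L) _ n ]′ x × [ false ∷_ , true ∷_ ]′ x ≡ y
  from {false ∷ b} p = inj₁ b , p , refl
  from {true ∷ b} (refl , refl) = inj₂ b , (weight b , refl ,
    +-cancelˡ-≡ (suc L ∸ alt b) _ _ (trans (m∸n+n≡m (m≤n⇒m≤1+n (alt≤ b))) (sym k+N)) , refl) , refl

-- A set containing L + 1 has sum above `n` as soon as `n ≤ L`, so the second term of `d-rec`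
-- vanishes. For `k` above L + 1, where `d-rec` does not apply, both counts are zero.
d-stable : ∀ {L k n} → n ≤ L → d L k n ≡ d n k n
d-stable {zero} z≤n = refl
d-stable {suc L} {k} {n} n≤L with m≤n⇒m<n∨m≡n n≤L
... | inj₂ refl = refl
... | inj₁ (s≤s n≤L′) = trans step (d-stable n≤L′)
  where
  step : d (suc L) k n ≡ d L k n
  step with k ≤? suc L
  ... | yes k≤ = trans (d-rec k (suc L ∸ k) L (m+[n∸m]≡n k≤) n)
                   (trans (cong (d L k n +_) (▹-small (suc L) (d L (suc L ∸ k)) (s≤s n≤L′))) (+-identityʳ _))
  ... | no k≰ = trans (d-large (suc L) k (≰⇒> k≰) n) (sym (d-large L k (<-trans (n<1+n L) (≰⇒> k≰)) n))

-- As d L k is qᵏ times the Gaussian binomial [L choose k] in q², these are its symmetry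
-- and the Pascal rule complementary to d-rec; each is used in the proof of the other.
d-sym : ∀ L k N → k + N ≡ L → N ▹ d L k ≗ k ▹ d L N
d-sym-suc : ∀ L k N → k + N ≡ L → N ▹ d (suc L) (suc k) ≗ suc k ▹ d (suc L) N
d-pascal : ∀ L k N → k + N ≡ L → d (suc L) (suc k) ≗ 1 ▹ d L k ⊕ 2 * suc k ▹ d L (suc k)

d-sym L zero zero eq n = refl
-- The case `k = 0` is the case `N = 0` read from right to left.
d-sym (suc L) zero (suc .L) refl n = sym (d-sym-suc L L zero (+-identityʳ L) n)
d-sym (suc L) (suc k) N eq n = d-sym-suc L k N (suc-injective eq) n

d-sym-suc L k N k+N n = begin
  -- After expansion by `d-pascal`, the first terms match by symmetry at level L and the second ones
  -- because their exponents agree; the result is the expansion of the right side by `d-rec`.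
  (N ▹ d (suc L) (suc k)) n
    ≡⟨ ▹-cong N (d-pascal L k N k+N) n ⟩
  (N ▹ (1 ▹ d L k ⊕ 2 * suc k ▹ d L (suc k))) n
    ≡⟨ ▹-⊕ N _ _ n ⟩
  (N ▹ 1 ▹ d L k) n + (N ▹ 2 * suc k ▹ d L (suc k)) n
    ≡⟨ cong₂ _+_ left (trans (▹-▹ N _ _ n) (trans (cong (λ i → (i ▹ d L (suc k)) n) exponent) (sym (▹-▹ (suc k) _ _ n)))) ⟩
  (suc k ▹ d L N) n + (suc k ▹ suc L ▹ d L (suc k)) n
    ≡⟨ ▹-⊕ (suc k) _ _ n ⟨
  (suc k ▹ (d L N ⊕ suc L ▹ d L (suc k))) n
    ≡⟨ ▹-cong (suc k) (d-rec N (suc k) L (trans (+-comm N (suc k)) (cong suc k+N))) n ⟨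
  (suc k ▹ d (suc L) N) n ∎
  where
  open ≡-Reasoning
  exponent : N + 2 * suc k ≡ suc k + suc L
  exponent = trans (arith k N) (cong (λ m → suc k + suc m) k+N)
    where
    arith : ∀ k N → N + 2 * suc k ≡ suc k + suc (k + N)
    arith = solve-∀
  left : (N ▹ 1 ▹ d L k) n ≡ (suc k ▹ d L N) n
  left = begin
    (N ▹ 1 ▹ d L k) n    ≡⟨ ▹-▹ N 1 _ n ⟩
    ((N + 1) ▹ d L k) n  ≡⟨ cong (λ i → (i ▹ d L k) n) (+-comm N 1) ⟩
    (suc N ▹ d L k) n    ≡⟨ ▹-▹ 1 N _ n ⟨
    (1 ▹ N ▹ d L k) n    ≡⟨ ▹-cong 1 (d-sym L k N k+N) n ⟩
    (1 ▹ k ▹ d L N) n    ≡⟨ ▹-▹ 1 k _ n ⟩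
    (suc k ▹ d L N) n ∎

-- At `N = 0`, where `k` is L, the term with `d L (suc L)` vanishes in `d-rec` and in the Pascal
-- rule alike; the remaining terms agree by `d-sym`.
d-pascal L k zero eq n with refl ← trans (sym (+-identityʳ k)) eq = begin
  d (suc L) (suc L) n
    ≡⟨ d-rec (suc L) 0 L (+-identityʳ _) n ⟩
  d L (suc L) n + (suc L ▹ d L 0) n
    ≡⟨ cong₂ _+_ (d-large L (suc L) ≤-refl n) (sym (trans (▹-cong 1 (d-sym L L 0 (+-identityʳ L)) n) (▹-▹ 1 L _ n))) ⟩
  (1 ▹ d L L) n
    ≡⟨ +-identityʳ _ ⟨
  (1 ▹ d L L) n + 0
    ≡⟨ cong ((1 ▹ d L L) n +_) (▹-zero (2 * suc L) (d-large L (suc L) ≤-refl) n) ⟨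
  (1 ▹ d L L) n + (2 * suc L ▹ d L (suc L)) n ∎
  where open ≡-Reasoning
d-pascal zero k (suc N) eq n with () ← trans (sym (+-suc k N)) eq
d-pascal (suc L) k (suc N) eq n = begin
  d (2 + L) (suc k) n
    ≡⟨ d-rec (suc k) (suc N) (suc L) (cong suc eq) n ⟩
  d (suc L) (suc k) n + ((2 + L) ▹ d (suc L) (suc N)) n
    ≡⟨ cong₂ _+_ (d-pascal L k N k+N n) (expand (2 + L) (d-rec (suc N) k L N+k)) ⟩
  -- All four terms are now at level L. Once the last is rewritten by symmetry, exchanging `y` and
  -- `z` leaves two expansions by `d-rec`, one for each term of the Pascal rule.
  x + y + (z + ((2 + L) ▹ suc L ▹ d L k) n)
    ≡⟨ cong (λ w → x + y + (z + w)) swap ⟩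
  x + y + (z + (2 * suc k ▹ suc L ▹ d L N) n)
    ≡⟨ arith x y z _ ⟩
  x + z + (y + (2 * suc k ▹ suc L ▹ d L N) n)
    ≡⟨ cong₂ _+_ (trans (expand 1 (d-rec k (suc N) L eq)) (cong (x +_) (▹-▹ 1 (suc L) _ n)))
                 (expand (2 * suc k) (d-rec (suc k) N L (trans (sym (+-suc k N)) eq))) ⟨
  (1 ▹ d (suc L) k) n + (2 * suc k ▹ d (suc L) (suc k)) n ∎
  where
  open ≡-Reasoning
  k+N : k + N ≡ L
  k+N = suc-injective (trans (sym (+-suc k N)) eq)
  N+k : suc N + k ≡ suc L
  N+k = trans (+-comm (suc N) k) eq
  x = (1 ▹ d L k) n
  y = (2 * suc k ▹ d L (suc k)) n
  z = ((2 + L) ▹ d L (suc N)) n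
  expand : ∀ i {f g h} → f ≗ g ⊕ h → (i ▹ f) n ≡ (i ▹ g) n + (i ▹ h) n
  expand i {g = g} {h} f≗ = trans (▹-cong i f≗ n) (▹-⊕ i g h n)
  arith : ∀ x y z w → x + y + (z + w) ≡ x + z + (y + w)
  arith = solve-∀
  -- With L = k + N, the exponent 2L + 3 splits as (3 + k + L) + N. Replacing the last N by k, as
  -- `d-sym` does, gives 2(k + 1) + (L + 1).
  e₁ : (2 + L) + suc L ≡ (3 + (k + L)) + N
  e₁ = trans (arith₁ L) (trans (cong (λ m → 3 + (m + L)) (sym k+N)) (arith₂ k N L))
    where
    arith₁ : ∀ L → (2 + L) + suc L ≡ 3 + (L + L)
    arith₁ = solve-∀
    arith₂ : ∀ k N L → 3 + (k + N + L) ≡ (3 + (k + L)) + N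
    arith₂ = solve-∀
  e₂ : ∀ k L → (3 + (k + L)) + k ≡ 2 * suc k + suc L
  e₂ = solve-∀
  swap : ((2 + L) ▹ suc L ▹ d L k) n ≡ (2 * suc k ▹ suc L ▹ d L N) n
  swap = begin
    ((2 + L) ▹ suc L ▹ d L k) n       ≡⟨ ▹-▹ (2 + L) (suc L) _ n ⟩
    (((2 + L) + suc L) ▹ d L k) n     ≡⟨ cong (λ i → (i ▹ d L k) n) e₁ ⟩
    (((3 + (k + L)) + N) ▹ d L k) n   ≡⟨ ▹-▹ (3 + (k + L)) N _ n ⟨
    ((3 + (k + L)) ▹ N ▹ d L k) n     ≡⟨ ▹-cong (3 + (k + L)) (d-sym L k N k+N) n ⟩
    ((3 + (k + L)) ▹ k ▹ d L N) n     ≡⟨ ▹-▹ (3 + (k + L)) k _ n ⟩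
    (((3 + (k + L)) + k) ▹ d L N) n   ≡⟨ cong (λ i → (i ▹ d L N) n) (e₂ k L) ⟩
    ((2 * suc k + suc L) ▹ d L N) n   ≡⟨ ▹-▹ (2 * suc k) (suc L) _ n ⟨
    (2 * suc k ▹ suc L ▹ d L N) n ∎

-- Removing the bound on the elements

-- A set with sum n lies in {1, …, n}, so this drops the bound on the parts.
d∞ : ℕ → ℕ → ℕ
d∞ k n = d n k n

d∞-rec : ∀ k → d∞ (suc k) ≗ 1 ▹ d∞ k ⊕ 2 * suc k ▹ d∞ (suc k)
d∞-rec k n = begin
  d n (suc k) n
    -- The level `k + n` is at least `n`, as stability asks, and of the form k + N that `d-pascal`
    -- asks for.
    ≡⟨ d-stable (m≤n⇒m≤1+n (m≤n+m n k)) ⟨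
  d (suc (k + n)) (suc k) n
    ≡⟨ d-pascal (k + n) k n refl n ⟩
  (1 ▹ d (k + n) k) n + (2 * suc k ▹ d (k + n) (suc k)) n
    ≡⟨ cong₂ _+_ (▹-cong≤ 1 n (λ m m≤n → d-stable (≤-trans m≤n (m≤n+m n k))))
                 (▹-cong≤ (2 * suc k) n (λ m m≤n → d-stable (≤-trans m≤n (m≤n+m n k)))) ⟩
  (1 ▹ d∞ k) n + (2 * suc k ▹ d∞ (suc k)) n ∎
  where open ≡-Reasoning

-- Pairs of subsets and their generating function

▹-comm : ∀ i j f → i ▹ j ▹ f ≗ j ▹ i ▹ f
▹-comm i j f n = trans (▹-▹ i j f n) (trans (cong (λ m → (m ▹ f) n) (+-comm i j)) (sym (▹-▹ j i f n)))

-- Multiplication by (1 + q²)(1 + q⁴)⋯(1 + q²ʲ).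
E : ℕ → (ℕ → ℕ) → ℕ → ℕ
E zero    f = f
E (suc j) f = E j f ⊕ 2 * suc j ▹ E j f

E-cong≤ : ∀ j {f g} n → (∀ m → m ≤ n → f m ≡ g m) → E j f n ≡ E j g n
E-cong≤ zero    n eq = eq n ≤-refl
E-cong≤ (suc j) n eq = cong₂ _+_ (E-cong≤ j n eq)
  (▹-cong≤ (2 * suc j) n (λ m m≤n → E-cong≤ j m (λ l l≤m → eq l (≤-trans l≤m m≤n))))

E-cong : ∀ j {f g} → f ≗ g → E j f ≗ E j g
E-cong j eq n = E-cong≤ j n (λ m _ → eq m)

E-▹ : ∀ j i f → E j (i ▹ f) ≗ i ▹ E j f
E-▹ zero    i f n = refl
E-▹ (suc j) i f n = begin
  E j (i ▹ f) n + (2 * suc j ▹ E j (i ▹ f)) n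
    ≡⟨ cong₂ _+_ (E-▹ j i f n) (trans (▹-cong (2 * suc j) (E-▹ j i f) n) (▹-comm (2 * suc j) i (E j f) n)) ⟩
  (i ▹ E j f) n + (i ▹ 2 * suc j ▹ E j f) n
    ≡⟨ ▹-⊕ i _ _ n ⟨
  (i ▹ E (suc j) f) n ∎
  where open ≡-Reasoning

+-interchange : ∀ a b c e → (a + b) + (c + e) ≡ (a + c) + (b + e)
+-interchange = solve-∀

E-⊕ : ∀ j f g → E j (f ⊕ g) ≗ E j f ⊕ E j g
E-⊕ zero    f g n = refl
E-⊕ (suc j) f g n = begin
  E j (f ⊕ g) n + (2 * suc j ▹ E j (f ⊕ g)) n
    ≡⟨ cong₂ _+_ (E-⊕ j f g n) (trans (▹-cong (2 * suc j) (E-⊕ j f g) n) (▹-⊕ (2 * suc j) _ _ n)) ⟩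
  (E j f n + E j g n) + ((2 * suc j ▹ E j f) n + (2 * suc j ▹ E j g) n)
    ≡⟨ +-interchange (E j f n) _ _ _ ⟩
  E (suc j) f n + E (suc j) g n ∎
  where open ≡-Reasoning

-- `c` encodes the sizes of multiplicity at least 2 and `b` those of odd multiplicity. The two words
-- have separate lengths so that inductions can run on `c` alone.
pairs : ∀ L′ L K k n → Finite (λ ((c , b) : Vec Bool L′ × Vec Bool L) →
          top c < K × alt b ≡ k × weight b + 2 * weight c ≡ n)
pairs L′ L K k n = finite
  (λ (c , b) → top c <? K ×-dec alt b ≟ k ×-dec weight b + 2 * weight c ≟ n)
  (cartesianProduct (allWords L′) (allWords L))
  (Unique.cartesianProduct⁺ (allWords-unique L′) (allWords-unique L))
  (λ _ → ∈-cartesianProduct⁺ (∈-allWords _) (∈-allWords _))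

pairs-zero : ∀ L j k n → card (pairs 0 L (suc j) k n) ≡ d L k n
pairs-zero L j k n = sym (card-bij (distinct L k n) (pairs 0 L (suc j) k n) ([] ,_) (λ { refl → refl })
  (λ { {b} (refl , refl) → s≤s z≤n , refl , +-identityʳ (weight b) })
  (λ { {[] , b} (_ , refl , refl) → b , (refl , sym (+-identityʳ (weight b))) , refl }))

-- Putting L′ + 1 into the first set adds 2(L′ + 1) to the total, and respects the bound `K`
-- whatever the other elements are.
pairs-suc : ∀ L′ L K k → suc L′ < K →
            (card ∘ pairs (suc L′) L K k) ≗ (card ∘ pairs L′ L K k) ⊕ 2 * suc L′ ▹ (card ∘ pairs L′ L K k)
pairs-suc L′ L K k L′<K n = sym (trans
  (trans (sym (cong (card (F n) +_) (card-shiftF (2 * suc L′) F n))) (sym (card-⊎F (F n) (shiftF (2 * suc L′) F n))))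
  (card-bij (F n ⊎F shiftF (2 * suc L′) F n) (pairs (suc L′) L K k n) f inj (λ {x} → to x) from))
  where
  F = pairs L′ L K k
  f : _ ⊎ _ → Vec Bool (suc L′) × Vec Bool L
  f (inj₁ (c , b)) = false ∷ c , b
  f (inj₂ (c , b)) = true ∷ c , b
  inj : ∀ {x y} → f x ≡ f y → x ≡ y
  inj {inj₁ _} {inj₁ _} refl = refl
  inj {inj₂ _} {inj₂ _} refl = refl
  arith : ∀ l c b → 2 * suc l + (b + 2 * c) ≡ b + 2 * (suc l + c)
  arith = solve-∀
  to : ∀ x → [ _ , Shifted (2 * suc L′) _ n ]′ x → _
  to (inj₁ _) p = p
  to (inj₂ (c , b)) (_ , refl , _ , altb , refl) = L′<K , altb , sym (arith L′ (weight c) (weight b))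
  from : ∀ {y} → _ → ∃ λ x → [ _ , Shifted (2 * suc L′) _ n ]′ x × f x ≡ y
  from {false ∷ c , b} p = inj₁ (c , b) , p , refl
  from {true ∷ c , b} (_ , altb , refl) = inj₂ (c , b) ,
    (weight b + 2 * weight c , arith L′ (weight c) (weight b) , ≤-<-trans (m≤n⇒m≤1+n (top≤ c)) L′<K , altb , refl) , refl

-- A first set containing L′ + 1 would violate `top c < K`.
pairs-skip : ∀ L′ L K k n → K ≤ suc L′ → card (pairs (suc L′) L K k n) ≡ card (pairs L′ L K k n)
pairs-skip L′ L K k n K≤ = sym (card-bij (pairs L′ L K k n) (pairs (suc L′) L K k n)
  (λ (c , b) → false ∷ c , b) (λ { refl → refl }) id
  (λ { {false ∷ c , b} p → (c , b) , p , refl ; {true ∷ c , b} (t , _) → contradiction t (≤⇒≯ K≤) }))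

card-pairs≤ : ∀ i L j k → i ≤ j → (card ∘ pairs i L (suc j) k) ≗ E i (d L k)
card-pairs≤ zero    L j k i≤j n = pairs-zero L j k n
card-pairs≤ (suc i) L j k i<j n = trans (pairs-suc i L (suc j) k (s≤s i<j) n)
  (cong₂ _+_ (ih n) (▹-cong (2 * suc i) ih n))
  where ih = card-pairs≤ i L j k (<⇒≤ i<j)

-- The elements 1, ..., `j` give the factors of `E j`; the `i` larger ones are excluded by the
-- bound.
card-pairs : ∀ i L j k → (card ∘ pairs (i + j) L (suc j) k) ≗ E j (d L k)
card-pairs zero    L j k n = card-pairs≤ j L j k ≤-refl n
card-pairs (suc i) L j k n = trans (pairs-skip (i + j) L (suc j) k n (s≤s (m≤n+m j i))) (card-pairs i L j k n)

-- G k counts the pairs (D, P) of sets with alternating sum of D equal to k + 1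
-- and all elements of P at most k, by the sum of D plus twice the sum of P.
G : ℕ → ℕ → ℕ
G k = E k (d∞ (suc k))

-- This is `d∞-rec` multiplied by the product in `E (suc k)`. The last factor 1 + q^(2k+2) splits
-- the term with `d∞ (suc k)` in two, which gives the recurrence the shape of `h-rec`.
G-suc : ∀ k → G (suc k) ≗ 2 * (2 + k) ▹ G (suc k) ⊕ (1 ▹ G k ⊕ suc (2 * suc k) ▹ G k)
G-suc k n = begin
  E (suc k) (d∞ (2 + k)) n
    ≡⟨ E-cong (suc k) (d∞-rec (suc k)) n ⟩
  E (suc k) (1 ▹ d∞ (suc k) ⊕ 2 * (2 + k) ▹ d∞ (2 + k)) n
    ≡⟨ E-⊕ (suc k) _ _ n ⟩
  E (suc k) (1 ▹ d∞ (suc k)) n + E (suc k) (2 * (2 + k) ▹ d∞ (2 + k)) n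
    ≡⟨ cong₂ _+_ (E-▹ (suc k) 1 _ n) (E-▹ (suc k) (2 * (2 + k)) _ n) ⟩
  (1 ▹ (G k ⊕ 2 * suc k ▹ G k)) n + (2 * (2 + k) ▹ G (suc k)) n
    ≡⟨ +-comm _ ((2 * (2 + k) ▹ G (suc k)) n) ⟩
  (2 * (2 + k) ▹ G (suc k)) n + (1 ▹ (G k ⊕ 2 * suc k ▹ G k)) n
    ≡⟨ cong ((2 * (2 + k) ▹ G (suc k)) n +_) (trans (▹-⊕ 1 _ _ n) (cong ((1 ▹ G k) n +_) (▹-▹ 1 (2 * suc k) _ n))) ⟩
  (2 * (2 + k) ▹ G (suc k)) n + ((1 ▹ G k) n + (suc (2 * suc k) ▹ G k) n) ∎
  where open ≡-Reasoning

-- Odd overpartitions by number of parts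

overpartitionsWithLength : ∀ n k → Finite (λ ps → IsOddOverpartition n ps × length ps ≡ k)
overpartitionsWithLength n k = restrict (oddOverpartitions n) (λ ps → length ps ≟ k)

h : ℕ → ℕ → ℕ
h k n = card (overpartitionsWithLength n k)

-- Both count only the empty object: in a nonempty set the elements below the largest have an
-- alternating sum smaller than it, so the difference is positive.
h-zero : h 0 ≗ d∞ 0
h-zero zero    = refl
h-zero (suc n) = trans
  (card-empty (overpartitionsWithLength (suc n) 0) (λ { {[]} (((_ , _ , ()) , _) , _) }))
  (sym (card-empty (distinct (suc n) 0 (suc n)) (λ {b} (altb , wb) → 1+n≢0 (trans (sym wb) (alt≡0 b altb)))))
  where
  alt≡0 : ∀ {L} (b : Vec Bool L) → alt b ≡ 0 → weight b ≡ 0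
  alt≡0 []                 _ = refl
  alt≡0 (false ∷ b)        e = alt≡0 b e
  alt≡0 {suc L} (true ∷ b) e = contradiction (m∸n≡0⇒m≤n e) (<⇒≱ (s≤s (alt≤ b)))

-- Adding 2 keeps sizes odd; the odd overpartitions without a part 1 are exactly the lifted ones.
lift : OverPart → OverPart
lift (a , o) = 2 + a , o

lift-injective : ∀ {p q} → lift p ≡ lift q → p ≡ q
lift-injective refl = refl

⊵⇒≥ : ∀ {p q} → p ⊵ q → size p ≥ size q
⊵⇒≥ (inj₁ a>b)        = <⇒≤ a>b
⊵⇒≥ (inj₂ (refl , _)) = ≤-refl

⊵-lift : ∀ {p q} → p ⊵ q → lift p ⊵ lift q
⊵-lift (inj₁ a>b)        = inj₁ (s≤s (s≤s a>b))
⊵-lift (inj₂ (refl , o)) = inj₂ (refl , o)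

⊵-unlift : ∀ {p q} → lift p ⊵ lift q → p ⊵ q
⊵-unlift (inj₁ (s≤s (s≤s a>b))) = inj₁ a>b
⊵-unlift (inj₂ (refl , o))      = inj₂ (refl , o)

Linked-∷ʳ⁺ : ∀ {A : Set} {R : A → A → Set} {xs x} → Linked R xs → All (λ y → R y x) xs → Linked R (xs ∷ʳ x)
Linked-∷ʳ⁺ []        []        = [-]
Linked-∷ʳ⁺ [-]       (q ∷ [])  = q ∷ [-]
Linked-∷ʳ⁺ (r ∷ rs)  (_ ∷ qs)  = r ∷ Linked-∷ʳ⁺ rs qs

Linked-∷ʳ⁻ : ∀ {A : Set} {R : A → A → Set} xs {x} → Linked R (xs ∷ʳ x) → Linked R xs
Linked-∷ʳ⁻ []           _        = []
Linked-∷ʳ⁻ (_ ∷ [])     _        = [-]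
Linked-∷ʳ⁻ (_ ∷ y ∷ xs) (r ∷ rs) = r ∷ Linked-∷ʳ⁻ (y ∷ xs) rs

sizes≥last : ∀ ps {q} → Linked _⊵_ (ps ∷ʳ q) → All (λ p → size q ≤ size p) ps
sizes≥last []           _        = []
sizes≥last (p ∷ [])     (r ∷ _)  = ⊵⇒≥ {p} r ∷ []
sizes≥last (p ∷ q ∷ ps) (r ∷ rs) with ih@(q≥ ∷ _) ← sizes≥last (q ∷ ps) rs = ≤-trans q≥ (⊵⇒≥ {p} {q} r) ∷ ih

-- Only the strict alternative of `_⊵_` lets an overlined part follow another; parts further left
-- are at least as large as its neighbour.
sizes>overlinedLast : ∀ ps {k} → Linked _⊵_ (ps ∷ʳ (k , true)) → All (λ p → k < size p) ps
sizes>overlinedLast []           _               = []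
sizes>overlinedLast (p ∷ [])     (inj₁ a>k ∷ _)  = a>k ∷ []
sizes>overlinedLast (p ∷ q ∷ ps) (r ∷ rs) with ih@(q> ∷ _) ← sizes>overlinedLast (q ∷ ps) rs = <-≤-trans q> (⊵⇒≥ {p} {q} r) ∷ ih

unlift : ∀ ps → All (λ p → 1 < size p) ps → ∃ λ qs → ps ≡ map lift qs
unlift []                        []       = [] , refl
unlift ((suc (suc a) , o) ∷ ps)  (_ ∷ rs) with qs , refl ← unlift ps rs = (a , o) ∷ qs , refl
unlift ((suc zero , o) ∷ ps)     (s≤s () ∷ _)

sum-sizes-∷ʳ : ∀ ps p → sum (map size (ps ∷ʳ p)) ≡ size p + sum (map size ps)
sum-sizes-∷ʳ ps p = begin
  sum (map size (ps ∷ʳ p))              ≡⟨ cong sum (map-++ size ps (p ∷ [])) ⟩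
  sum (map size ps ++ size p ∷ [])      ≡⟨ sum-++ (map size ps) (size p ∷ []) ⟩
  sum (map size ps) + (size p + 0)      ≡⟨ cong (sum (map size ps) +_) (+-identityʳ (size p)) ⟩
  sum (map size ps) + size p            ≡⟨ +-comm (sum (map size ps)) (size p) ⟩
  size p + sum (map size ps)            ∎
  where open ≡-Reasoning

length-∷ʳ : ∀ {A : Set} (xs : List A) x → length (xs ∷ʳ x) ≡ suc (length xs)
length-∷ʳ xs x = trans (length-++ xs) (+-comm (length xs) 1)

sum-sizes-lift : ∀ qs → sum (map size (map lift qs)) ≡ 2 * length qs + sum (map size qs)
sum-sizes-lift []             = refl
sum-sizes-lift ((a , o) ∷ qs) = trans (cong (2 + a +_) (sum-sizes-lift qs)) (arith a (length qs) _)
  where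
  arith : ∀ a l s → 2 + a + (2 * l + s) ≡ 2 * suc l + (a + s)
  arith = solve-∀

OddOver : List OverPart → Set
OddOver ps = Linked _⊵_ ps × All (Odd ∘ size) ps

odd⇒positive : ∀ {k} → Odd k → 0 < k
odd⇒positive {suc k} _ = s≤s z≤n

toOddOver : ∀ {n ps} → IsOddOverpartition n ps → OddOver ps × sum (map size ps) ≡ n
toOddOver ((_ , l , s) , o) = (l , All.map⁻ o) , s

fromOddOver : ∀ {n ps} → OddOver ps → sum (map size ps) ≡ n → IsOddOverpartition n ps
fromOddOver (l , o) s = (All.map⁺ (All.map odd⇒positive o) , l , s) , All.map⁺ o

oddOver-lift : ∀ {qs} → OddOver qs → OddOver (map lift qs)
oddOver-lift (l , o) = Linked.map⁺ (Linked.map (λ {p} {q} → ⊵-lift {p} {q}) l) , All.map⁺ o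

oddOver-unlift : ∀ {qs} → OddOver (map lift qs) → OddOver qs
oddOver-unlift (l , o) = Linked.map (λ {p} {q} → ⊵-unlift {p} {q}) (Linked.map⁻ l) , All.map⁻ o

oddOver-∷ʳ⁻ : ∀ ps {p} → OddOver (ps ∷ʳ p) → OddOver ps × Odd (size p)
oddOver-∷ʳ⁻ ps (l , o) = (Linked-∷ʳ⁻ ps l , proj₁ (All.∷ʳ⁻ o)) , proj₂ (All.∷ʳ⁻ o)

oddOver-∷ʳ-one : ∀ {ps} → OddOver ps → OddOver (ps ∷ʳ (1 , false))
oddOver-∷ʳ-one (l , o) = Linked-∷ʳ⁺ l (All.map (λ {p} → one p) o) , All.∷ʳ⁺ o refl
  where
  one : ∀ p → Odd (size p) → p ⊵ (1 , false)
  one (suc zero , _)    _ = inj₂ (refl , refl)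
  one (suc (suc a) , _) _ = inj₁ (s≤s (s≤s z≤n))

-- An overlined 1 must be the first 1, so only larger parts may precede it. Lifting k parts and
-- adding this 1 accounts for the exponent 2k + 1 in `h-rec`.
oddOver-∷ʳ-overlinedOne : ∀ {qs} → OddOver qs → OddOver (map lift qs ∷ʳ (1 , true))
oddOver-∷ʳ-overlinedOne oo@(_ , o) with l , o′ ← oddOver-lift oo =
  Linked-∷ʳ⁺ l (All.map⁺ (All.map (λ _ → inj₁ (s≤s (s≤s z≤n))) o)) , All.∷ʳ⁺ o′ refl

-- According to the last part: larger than 1, a plain 1, or an overlined 1.
h-rec : ∀ k → h (suc k) ≗ 2 * suc k ▹ h (suc k) ⊕ (1 ▹ h k ⊕ suc (2 * k) ▹ h k)
h-rec k n = sym (begin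
  (2 * suc k ▹ h (suc k)) n + ((1 ▹ h k) n + (suc (2 * k) ▹ h k) n)
    ≡⟨ cong₂ _+_ (card-shiftF (2 * suc k) (F (suc k)) n)
         (cong₂ _+_ (card-shiftF 1 (F k) n) (card-shiftF (suc (2 * k)) (F k) n)) ⟨
  card F₁ + (card F₂ + card F₃)
    ≡⟨ cong (card F₁ +_) (card-⊎F F₂ F₃) ⟨
  card F₁ + card (F₂ ⊎F F₃)
    ≡⟨ card-⊎F F₁ (F₂ ⊎F F₃) ⟨
  card (F₁ ⊎F (F₂ ⊎F F₃))
    ≡⟨ card-bij (F₁ ⊎F (F₂ ⊎F F₃)) (overpartitionsWithLength n (suc k)) f (λ {x} {y} → inj x y) (λ {x} → to x) from ⟩
  h (suc k) n ∎)
  where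
  open ≡-Reasoning
  F : ∀ k m → Finite (λ ps → IsOddOverpartition m ps × length ps ≡ k)
  F k m = overpartitionsWithLength m k
  F₁ = shiftF (2 * suc k) (F (suc k)) n
  F₂ = shiftF 1 (F k) n
  F₃ = shiftF (suc (2 * k)) (F k) n
  f : List OverPart ⊎ (List OverPart ⊎ List OverPart) → List OverPart
  f (inj₁ qs)        = map lift qs
  f (inj₂ (inj₁ qs)) = qs ∷ʳ (1 , false)
  f (inj₂ (inj₂ qs)) = map lift qs ∷ʳ (1 , true)
  map-lift-injective = map-injective lift-injective
  map-lift≢∷ʳ : ∀ qs ps {o} → map lift qs ≢ ps ∷ʳ (1 , o)
  map-lift≢∷ʳ (_ ∷ [])     []       ()
  map-lift≢∷ʳ (_ ∷ q ∷ qs) []       ()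
  map-lift≢∷ʳ (q ∷ qs)     (p ∷ ps) eq = map-lift≢∷ʳ qs ps (∷-injectiveʳ eq)
  last≢ : ∀ (qs ps : List OverPart) → qs ∷ʳ (1 , false) ≢ ps ∷ʳ (1 , true)
  last≢ qs ps eq with () ← ∷ʳ-injectiveʳ qs ps eq
  inj : ∀ x y → f x ≡ f y → x ≡ y
  inj (inj₁ _)         (inj₁ _)         eq = cong inj₁ (map-lift-injective eq)
  inj (inj₁ _)         (inj₂ (inj₁ _))  eq = contradiction eq (map-lift≢∷ʳ _ _)
  inj (inj₁ _)         (inj₂ (inj₂ _))  eq = contradiction eq (map-lift≢∷ʳ _ _)
  inj (inj₂ (inj₁ _))  (inj₁ _)         eq = contradiction (sym eq) (map-lift≢∷ʳ _ _)
  inj (inj₂ (inj₁ _))  (inj₂ (inj₁ _))  eq = cong (inj₂ ∘ inj₁) (∷ʳ-injectiveˡ _ _ eq)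
  inj (inj₂ (inj₁ _))  (inj₂ (inj₂ _))  eq = contradiction eq (last≢ _ _)
  inj (inj₂ (inj₂ _))  (inj₁ _)         eq = contradiction (sym eq) (map-lift≢∷ʳ _ _)
  inj (inj₂ (inj₂ _))  (inj₂ (inj₁ _))  eq = contradiction (sym eq) (last≢ _ _)
  inj (inj₂ (inj₂ _))  (inj₂ (inj₂ _))  eq = cong (inj₂ ∘ inj₂) (map-lift-injective (∷ʳ-injectiveˡ _ _ eq))
  P : ℕ → ℕ → List OverPart → Set
  P k m ps = IsOddOverpartition m ps × length ps ≡ k
  Branches : List OverPart ⊎ (List OverPart ⊎ List OverPart) → Set
  Branches = [ Shifted (2 * suc k) (P (suc k)) n , [ Shifted 1 (P k) n , Shifted (suc (2 * k)) (P k) n ]′ ]′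
  to : ∀ x → Branches x → P (suc k) n (f x)
  to (inj₁ qs) (_ , refl , p , l) with oo , refl ← toOddOver p =
    fromOddOver (oddOver-lift oo) (trans (sum-sizes-lift qs) (cong (λ m → 2 * m + sum (map size qs)) l)) , trans (length-map lift qs) l
  to (inj₂ (inj₁ qs)) (_ , refl , p , refl) with oo , refl ← toOddOver p =
    fromOddOver (oddOver-∷ʳ-one oo) (sum-sizes-∷ʳ qs _) , length-∷ʳ qs _
  to (inj₂ (inj₂ qs)) (_ , refl , p , refl) with oo , refl ← toOddOver p =
    fromOddOver (oddOver-∷ʳ-overlinedOne oo)
      (trans (sum-sizes-∷ʳ (map lift qs) _) (cong suc (sum-sizes-lift qs))) ,
    trans (length-∷ʳ (map lift qs) _) (cong suc (length-map lift qs))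
  from : ∀ {ps} → P (suc k) n ps → ∃ λ x → Branches x × f x ≡ ps
  from {ps} (p , l) with oo , s ← toOddOver p with initLast ps
  ... | ps′ ∷ʳ′ (zero , o) with _ , () ← oddOver-∷ʳ⁻ ps′ oo
  ... | ps′ ∷ʳ′ (suc zero , false) = inj₂ (inj₁ ps′) ,
    (sum (map size ps′) , trans (sym (sum-sizes-∷ʳ ps′ _)) s ,
      fromOddOver (proj₁ (oddOver-∷ʳ⁻ ps′ oo)) refl , suc-injective (trans (sym (length-∷ʳ ps′ _)) l)) , refl
  ... | ps′ ∷ʳ′ (suc zero , true) with qs , refl ← unlift ps′ (sizes>overlinedLast ps′ (proj₁ oo)) = inj₂ (inj₂ qs) ,
    (sum (map size qs) ,
      trans (cong (λ m → suc (2 * m) + sum (map size qs)) (sym len)) (trans (cong suc (sym (sum-sizes-lift qs))) (trans (sym (sum-sizes-∷ʳ (map lift qs) _)) s)) ,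
      fromOddOver (oddOver-unlift (proj₁ (oddOver-∷ʳ⁻ (map lift qs) oo))) refl , len) , refl
    where
    len : length qs ≡ k
    len = suc-injective (trans (sym (trans (length-∷ʳ (map lift qs) _) (cong suc (length-map lift qs)))) l)
  -- A last part of at least 2 forces every part to be at least 2, so the whole list can be
  -- unlifted.
  ... | ps′ ∷ʳ′ q@(suc (suc a) , o) with qs , eq ← unlift (ps′ ∷ʳ q)
          (All.∷ʳ⁺ (All.map (≤-trans (s≤s (s≤s z≤n))) (sizes≥last ps′ (proj₁ oo))) (s≤s (s≤s z≤n))) = inj₁ qs ,
    (sum (map size qs) ,
      trans (cong (λ m → 2 * m + sum (map size qs)) (sym len)) (trans (sym (sum-sizes-lift qs)) (trans (cong (sum ∘ map size) (sym eq)) s)) ,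
      fromOddOver (oddOver-unlift (subst OddOver eq oo)) refl , len) , sym eq
    where
    len : length qs ≡ suc k
    len = trans (sym (length-map lift qs)) (trans (cong length (sym eq)) l)

-- Comparison of the two recurrences

-- Both sides solve the same fixed-point equation. The factor 2 arises at `k = 0`, where a final 1,
-- plain or overlined, contributes the same term `1 ▹ h 0`; from there on it is carried along.
h≗G⊕G : ∀ k → h (suc k) ≗ G k ⊕ G k
h≗G⊕G zero = ▹-fixpoint-unique 1 (λ n → trans (h-rec 0 n) (cong ((2 ▹ h 1) n +_) (cong₂ _+_ (▹-cong 1 h-zero n) (▹-cong 1 h-zero n))))
  (λ n → trans (cong₂ _+_ (d∞-rec 0 n) (d∞-rec 0 n)) (trans (arith ((1 ▹ d∞ 0) n) _)
     (cong (_+ ((1 ▹ d∞ 0) n + (1 ▹ d∞ 0) n)) (sym (▹-⊕ 2 (G 0) (G 0) n)))))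
  where
  arith : ∀ x y → (x + y) + (x + y) ≡ (y + y) + (x + x)
  arith = solve-∀
h≗G⊕G (suc k) = ▹-fixpoint-unique _
  (λ n → trans (h-rec (suc k) n) (cong ((2 * (2 + k) ▹ h (2 + k)) n +_)
    (cong₂ _+_ (twice 1 n) (twice (suc (2 * suc k)) n))))
  (λ n → trans (cong₂ _+_ (G-suc k n) (G-suc k n)) (trans (arith ((2 * (2 + k) ▹ G (suc k)) n) ((1 ▹ G k) n) ((suc (2 * suc k) ▹ G k) n))
     (cong (_+ ((1 ▹ G k) n + (1 ▹ G k) n + ((suc (2 * suc k) ▹ G k) n + (suc (2 * suc k) ▹ G k) n))) (sym (▹-⊕ (2 * (2 + k)) (G (suc k)) (G (suc k)) n)))))
  where
  twice : ∀ i n → (i ▹ h (suc k)) n ≡ (i ▹ G k) n + (i ▹ G k) n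
  twice i n = trans (▹-cong i (h≗G⊕G k) n) (▹-⊕ i (G k) (G k) n)
  arith : ∀ x y z → (x + (y + z)) + (x + (y + z)) ≡ (x + x) + ((y + y) + (z + z))
  arith = solve-∀

-- Finite sums and summation over fibres

Σ< : ℕ → (ℕ → ℕ) → ℕ
Σ< zero    f = 0
Σ< (suc K) f = Σ< K f + f K

Σ<-cong : ∀ K {f g} → (∀ k → k < K → f k ≡ g k) → Σ< K f ≡ Σ< K g
Σ<-cong zero    eq = refl
Σ<-cong (suc K) eq = cong₂ _+_ (Σ<-cong K (λ k k<K → eq k (m<n⇒m<1+n k<K))) (eq K ≤-refl)

Σ<-⊕ : ∀ K f g → Σ< K (f ⊕ g) ≡ Σ< K f + Σ< K g
Σ<-⊕ zero    f g = refl
Σ<-⊕ (suc K) f g = trans (cong (_+ (f K + g K)) (Σ<-⊕ K f g)) (+-interchange (Σ< K f) _ _ _)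

Σ<-zero : ∀ K → Σ< K (λ _ → 0) ≡ 0
Σ<-zero zero    = refl
Σ<-zero (suc K) = trans (+-identityʳ _) (Σ<-zero K)

Σ<-suc : ∀ K f → Σ< (suc K) f ≡ f 0 + Σ< K (f ∘ suc)
Σ<-suc zero    f = +-comm 0 (f 0)
Σ<-suc (suc K) f = trans (cong (_+ f (suc K)) (Σ<-suc K f)) (+-assoc (f 0) _ _)

δ : ℕ → ℕ → ℕ
δ a k = if does (a ≟ k) then 1 else 0

Σ<-δ : ∀ K a → a < K → Σ< K (δ a) ≡ 1
Σ<-δ (suc K) a a<1+K with m≤n⇒m<n∨m≡n (s≤s⁻¹ a<1+K)
... | inj₁ a<K = cong₂ _+_ (Σ<-δ K a a<K) (cong (if_then 1 else 0) (dec-false (a ≟ K) (<⇒≢ a<K)))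
... | inj₂ refl = cong₂ _+_
  (trans (Σ<-cong K (λ k k<K → cong (if_then 1 else 0) (dec-false (K ≟ k) (>⇒≢ k<K)))) (Σ<-zero K))
  (cong (if_then 1 else 0) (dec-true (K ≟ K) refl))

-- Each element is counted in exactly one fibre, which is what `Σ<-δ` expresses.
length-fibres : ∀ {A : Set} (f : A → ℕ) K {xs} → All (λ x → f x < K) xs →
                length xs ≡ Σ< K (λ k → length (filter (λ x → f x ≟ k) xs))
length-fibres f K []                    = sym (Σ<-zero K)
length-fibres f K {x ∷ xs} (fx<K ∷ all) = begin
  suc (length xs)
    ≡⟨ cong₂ _+_ (Σ<-δ K (f x) fx<K) (sym (length-fibres f K all)) ⟨
  Σ< K (δ (f x)) + Σ< K (λ k → length (filter (λ x → f x ≟ k) xs))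
    ≡⟨ Σ<-⊕ K _ _ ⟨
  Σ< K (δ (f x) ⊕ (λ k → length (filter (λ x → f x ≟ k) xs)))
    ≡⟨ Σ<-cong K (λ k _ → step k) ⟩
  Σ< K (λ k → length (filter (λ x → f x ≟ k) (x ∷ xs))) ∎
  where
  open ≡-Reasoning
  step : ∀ k → δ (f x) k + length (filter (λ x → f x ≟ k) xs) ≡ length (filter (λ x → f x ≟ k) (x ∷ xs))
  step k with does (f x ≟ k)
  ... | true  = refl
  ... | false = refl

card-fibres : ∀ {A : Set} {P : A → Set} (F : Finite P) (f : A → ℕ) K → (∀ {x} → P x → f x < K) →
              card F ≡ Σ< K (λ k → card (restrict F (λ x → f x ≟ k)))
card-fibres F f K bound = length-fibres f K (All.tabulate (λ x∈ → bound (∈⇒ F x∈)))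

-- The fibres are those of the number of parts, at most n + 1 because parts are positive. The fibre
-- over 0 is empty, hence the shifted index.
p̄odd-Σ : ∀ n → p̄odd (suc n) ≡ Σ< (suc n) (λ k → h (suc k) (suc n))
p̄odd-Σ n = trans (card-fibres (oddOverpartitions (suc n)) length (2 + n) bound)
  (trans (Σ<-suc (suc n) (λ k → h k (suc n))) (cong (_+ Σ< (suc n) (λ k → h (suc k) (suc n))) (card-empty (overpartitionsWithLength (suc n) 0) λ { {[]} (((_ , _ , ()) , _) , _) })))
  where
  bound : ∀ {ps} → IsOddOverpartition (suc n) ps → length ps < 2 + n
  bound {ps} ((pos , _ , s) , _) = s≤s (subst (length ps ≤_) s (length≤sum size pos))

-- Encoding simply paired partitions by pairs of subsets

bit : Bool → ℕ
bit false = 0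
bit true  = 1

-- A multiplicity from 0 to 3 in binary: the high bit tells whether it is at least 2, the low bit
-- whether it is odd.
digit : Bool → Bool → ℕ
digit c b = 2 * bit c + bit b

build : ∀ {L} → Vec Bool L → Vec Bool L → List ℕ
build []              []      = []
build {suc L} (c ∷ cs) (b ∷ bs) = replicate (digit c b) (suc L) ++ build cs bs

parts : ∀ {L} → Vec Bool L → List ℕ
parts []                 = []
parts {suc L} (true ∷ b) = suc L ∷ parts b
parts (false ∷ b)        = parts b

build≤ : ∀ {L} (c b : Vec Bool L) → All (_≤ L) (build c b)
build≤ []       []       = []
build≤ (c ∷ cs) (b ∷ bs) = All.++⁺ (All.replicate⁺ (digit c b) ≤-refl) (All.map m≤n⇒m≤1+n (build≤ cs bs))

build-positive : ∀ {L} (c b : Vec Bool L) → All (0 <_) (build c b)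
build-positive []       []       = []
build-positive (c ∷ cs) (b ∷ bs) = All.++⁺ (All.replicate⁺ (digit c b) (s≤s z≤n)) (build-positive cs bs)

Linked-∷⁺ : ∀ {A : Set} {R : A → A → Set} {x xs} → All (R x) xs → Linked R xs → Linked R (x ∷ xs)
Linked-∷⁺ []      _  = [-]
Linked-∷⁺ (r ∷ _) rs = r ∷ rs

build-linked : ∀ {L} (c b : Vec Bool L) → Linked _≥_ (build c b)
build-linked []               []       = []
build-linked {suc L} (c ∷ cs) (b ∷ bs) = go (digit c b)
  where
  go : ∀ a → Linked _≥_ (replicate a (suc L) ++ build cs bs)
  go zero    = build-linked cs bs
  go (suc a) = Linked-∷⁺ (All.++⁺ (All.replicate⁺ a ≤-refl) (All.map m≤n⇒m≤1+n (build≤ cs bs))) (go a)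

sum-replicate : ∀ a m → sum (replicate a m) ≡ a * m
sum-replicate zero    m = refl
sum-replicate (suc a) m = cong (m +_) (sum-replicate a m)

build-sum : ∀ {L} (c b : Vec Bool L) → sum (build c b) ≡ weight b + 2 * weight c
build-sum []               []       = refl
build-sum {suc L} (c ∷ cs) (b ∷ bs) = trans (sum-++ (replicate (digit c b) (suc L)) (build cs bs))
  (trans (cong₂ _+_ (sum-replicate (digit c b) (suc L)) (build-sum cs bs)) (arith c b))
  where
  arith₁ : ∀ l u v → 1 * suc l + (u + 2 * v) ≡ suc l + u + 2 * v
  arith₁ = solve-∀
  arith₂ : ∀ l u v → 2 * suc l + (u + 2 * v) ≡ u + 2 * (suc l + v)
  arith₂ = solve-∀
  arith₃ : ∀ l u v → 3 * suc l + (u + 2 * v) ≡ suc l + u + 2 * (suc l + v)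
  arith₃ = solve-∀
  arith : ∀ c b → digit c b * suc L + (weight bs + 2 * weight cs) ≡ weight (b ∷ bs) + 2 * weight (c ∷ cs)
  arith false false = refl
  arith false true  = arith₁ L (weight bs) (weight cs)
  arith true  false = arith₂ L (weight bs) (weight cs)
  arith true  true  = arith₃ L (weight bs) (weight cs)

multiplicity-++ : ∀ k xs ys → multiplicity k (xs ++ ys) ≡ multiplicity k xs + multiplicity k ys
multiplicity-++ k xs ys = trans (cong length (filter-++ (k ≟_) xs ys)) (length-++ (filter (k ≟_) xs))

multiplicity-absent : ∀ {k xs} → All (k ≢_) xs → multiplicity k xs ≡ 0
multiplicity-absent all = cong length (filter-none (_ ≟_) all)

multiplicity-replicate : ∀ a k → multiplicity k (replicate a k) ≡ a
multiplicity-replicate a k = trans (cong length (filter-all (k ≟_) (All.replicate⁺ a refl))) (length-replicate a)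

multiplicity-top : ∀ a {m ys} → All (_< m) ys → multiplicity m (replicate a m ++ ys) ≡ a
multiplicity-top a {m} {ys} ys<m = trans (multiplicity-++ m (replicate a m) ys)
  (trans (cong₂ _+_ (multiplicity-replicate a m) (multiplicity-absent (All.map >⇒≢ ys<m))) (+-identityʳ a))

multiplicity-below : ∀ a {m k} ys → k < m → multiplicity k (replicate a m ++ ys) ≡ multiplicity k ys
multiplicity-below a {m} {k} ys k<m = trans (multiplicity-++ k (replicate a m) ys)
  (cong (_+ multiplicity k ys) (multiplicity-absent (All.replicate⁺ a (<⇒≢ k<m))))

digit≤3 : ∀ c b → digit c b ≤ 3
digit≤3 false false = z≤n
digit≤3 false true  = s≤s z≤n
digit≤3 true  false = s≤s (s≤s z≤n)
digit≤3 true  true  = ≤-refl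

build-simplyPaired : ∀ {L} (c b : Vec Bool L) → SimplyPaired (build c b)
build-simplyPaired []               []       = []
build-simplyPaired {suc L} (c ∷ cs) (b ∷ bs) = All.++⁺
  (All.replicate⁺ (digit c b) (subst (_≤ 3) (sym (multiplicity-top (digit c b) (All.map s≤s (build≤ cs bs)))) (digit≤3 c b)))
  (All.zipWith (λ (k≤L , μ≤3) → subst (_≤ 3) (sym (multiplicity-below (digit c b) (build cs bs) (s≤s k≤L))) μ≤3)
    (build≤ cs bs , build-simplyPaired cs bs))

filter-cong : ∀ {A : Set} {P Q : A → Set} (P? : Decidable P) (Q? : Decidable Q) {xs} →
              All (λ x → does (P? x) ≡ does (Q? x)) xs → filter P? xs ≡ filter Q? xs
filter-cong P? Q? []         = refl
filter-cong P? Q? {x ∷ xs} (eq ∷ eqs) with does (P? x) | does (Q? x) | eq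
... | false | _ | refl = filter-cong P? Q? eqs
... | true  | _ | refl = cong (x ∷_) (filter-cong P? Q? eqs)

module _ {Q : ℕ → Set} (Q? : Decidable Q) where

  withMultiplicity : List ℕ → List ℕ
  withMultiplicity xs = filter (λ k → Q? (multiplicity k xs)) xs

  -- The copies of `m` all have multiplicity `a`, so they are kept or dropped together, and they
  -- leave the multiplicities of smaller entries unchanged. This serves both `oddSizes` and `r`.
  withMultiplicity-top : ∀ a {m ys} → All (_< m) ys →
    withMultiplicity (replicate a m ++ ys) ≡ (if does (Q? a) then replicate a m else []) ++ withMultiplicity ys
  withMultiplicity-top a {m} {ys} ys<m = trans (filter-++ _ (replicate a m) ys) (cong₂ _++_ top-part
    (filter-cong _ _ (All.map (λ k<m → cong (does ∘ Q?) (multiplicity-below a ys k<m)) ys<m)))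
    where
    Q?′ : Decidable (λ k → Q (multiplicity k (replicate a m ++ ys)))
    Q?′ k = Q? (multiplicity k (replicate a m ++ ys))
    top-part : filter Q?′ (replicate a m) ≡ (if does (Q? a) then replicate a m else [])
    top-part with Q? a
    ... | yes q = filter-all Q?′ (All.replicate⁺ a (subst Q (sym (multiplicity-top a ys<m)) q))
    ... | no ¬q = filter-none Q?′ (All.replicate⁺ a (¬q ∘ subst Q (multiplicity-top a ys<m)))

deduplicate-top : ∀ a {m zs} → All (_≢ m) (deduplicate _≟_ zs) →
                  deduplicate _≟_ (replicate (suc a) m ++ zs) ≡ m ∷ deduplicate _≟_ zs
deduplicate-top zero    {m} zs≢m = cong (m ∷_) (filter-all (¬? ∘ (m ≟_)) (All.map (λ z≢m → z≢m ∘ sym) zs≢m))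
deduplicate-top (suc a) {m} zs≢m = cong (m ∷_) (trans
  (cong (filter (¬? ∘ (m ≟_))) (deduplicate-top a zs≢m))
  (trans (filter-reject (¬? ∘ (m ≟_)) (λ m≢m → m≢m refl))
         (filter-all (¬? ∘ (m ≟_)) (All.map (λ z≢m → z≢m ∘ sym) zs≢m))))

parts≤ : ∀ {L} (b : Vec Bool L) → All (_≤ L) (parts b)
parts≤ []          = []
parts≤ (true ∷ b)  = ≤-refl ∷ All.map m≤n⇒m≤1+n (parts≤ b)
parts≤ (false ∷ b) = All.map m≤n⇒m≤1+n (parts≤ b)

build-oddSizes : ∀ {L} (c b : Vec Bool L) → oddSizes (build c b) ≡ parts b
build-oddSizes []               []       = refl
build-oddSizes {suc L} (c ∷ cs) (b ∷ bs) = trans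
  (cong (deduplicate _≟_) (withMultiplicity-top odd? (digit c b) (All.map s≤s (build≤ cs bs)))) (go c b)
  where
  zs = withMultiplicity odd? (build cs bs)
  ih : deduplicate _≟_ zs ≡ parts bs
  ih = build-oddSizes cs bs
  fresh : All (_≢ suc L) (deduplicate _≟_ zs)
  fresh = subst (All (_≢ suc L)) (sym ih) (All.map (<⇒≢ ∘ s≤s) (parts≤ bs))
  go : ∀ c b → deduplicate _≟_ ((if does (odd? (digit c b)) then replicate (digit c b) (suc L) else []) ++ zs)
         ≡ parts (b ∷ bs)
  go false false = ih
  go true  false = ih
  -- The block has one or three copies; `deduplicate-top` takes one less than that number.
  go false true  = trans (deduplicate-top 0 fresh) (cong (suc L ∷_) ih)
  go true  true  = trans (deduplicate-top 2 fresh) (cong (suc L ∷_) ih)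

-- By `alt≤`, integer and truncated subtraction agree at every step.
alternatingSum-parts : ∀ {L} (b : Vec Bool L) → alternatingSum (parts b) ≡ ℤ.+ alt b
alternatingSum-parts []                 = refl
alternatingSum-parts (false ∷ b)        = alternatingSum-parts b
alternatingSum-parts {suc L} (true ∷ b) = trans (cong (λ z → ℤ.+ suc L ℤ.- z) (alternatingSum-parts b))
  (trans (ℤ.m-n≡m⊖n (suc L) (alt b)) (ℤ.⊖-≥ (m≤n⇒m≤1+n (alt≤ b))))

build-r : ∀ {L} (c b : Vec Bool L) → r (build c b) ≡ top c
build-r []               []       = refl
build-r {suc L} (c ∷ cs) (b ∷ bs) = trans
  (cong (max 0) (withMultiplicity-top (2 ≤?_) (digit c b) (All.map s≤s (build≤ cs bs)))) (go c b)
  where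
  zs = withMultiplicity (2 ≤?_) (build cs bs)
  ih : max 0 zs ≡ top cs
  ih = build-r cs bs
  zs≤ : All (_≤ suc L) zs
  zs≤ = All.filter⁺ (λ k → 2 ≤? multiplicity k (build cs bs)) (All.map m≤n⇒m≤1+n (build≤ cs bs))
  go : ∀ c b → max 0 ((if does (2 ≤? digit c b) then replicate (digit c b) (suc L) else []) ++ zs) ≡ top (c ∷ cs)
  go false false = ih
  go false true  = ih
  -- Here L + 1 heads the list and bounds all its entries, so it is the maximum.
  go true  b     = max≈v⁺ (here refl) (All.++⁺ (All.replicate⁺ (digit true b) ≤-refl) zs≤) z≤n

build-ρ : ∀ {L} (c b : Vec Bool L) → ρ (build c b) ≡ ℤ.+ top c ℤ.- ℤ.+ alt b
build-ρ c b = cong₂ (λ x y → ℤ.+ x ℤ.- y) (build-r c b)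
  (trans (cong alternatingSum (build-oddSizes c b)) (alternatingSum-parts b))

negative⇒< : ∀ {m n} → ℤ.+ m ℤ.- ℤ.+ n ℤ.< ℤ.0ℤ → m < n
negative⇒< {m} {n} lt with m <? n
... | yes m<n = m<n
... | no m≮n with () ← ℤ.drop‿+<+ (subst (ℤ._< ℤ.0ℤ) (trans (ℤ.m-n≡m⊖n m n) (ℤ.⊖-≥ (≮⇒≥ m≮n))) lt)

<⇒negative : ∀ {m n} → m < n → ℤ.+ m ℤ.- ℤ.+ n ℤ.< ℤ.0ℤ
<⇒negative {m} {n} m<n = subst₂ ℤ._<_ (sym (ℤ.m-n≡m⊖n m n)) (ℤ.n⊖n≡0 n) (ℤ.⊖-monoˡ-< n m<n)

-- Entries below `m` cannot continue a block of copies of `m`, so the length of the block can be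
-- read off.
replicate-++-injective : ∀ a a′ {m xs ys} → All (_< m) xs → All (_< m) ys →
  replicate a m ++ xs ≡ replicate a′ m ++ ys → a ≡ a′ × xs ≡ ys
replicate-++-injective zero    zero     _        _        eq   = refl , eq
replicate-++-injective zero    (suc a′) (m< ∷ _) _        refl = contradiction m< (<-irrefl refl)
replicate-++-injective (suc a) zero     _        (m< ∷ _) refl = contradiction m< (<-irrefl refl)
replicate-++-injective (suc a) (suc a′) xs<      ys<      eq
  with refl , eq′ ← replicate-++-injective a a′ xs< ys< (∷-injectiveʳ eq) = refl , eq′

digit-injective : ∀ c b c′ b′ → digit c b ≡ digit c′ b′ → c ≡ c′ × b ≡ b′
digit-injective false false false false refl = refl , refl
digit-injective false true  false true  refl = refl , refl
digit-injective true  false false false ()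
digit-injective true  false false true  ()
digit-injective true  true  false false ()
digit-injective true  true  false true  ()
digit-injective true  false true  false refl = refl , refl
digit-injective true  true  true  true  refl = refl , refl

build-injective : ∀ {L} (c b c′ b′ : Vec Bool L) → build c b ≡ build c′ b′ → c ≡ c′ × b ≡ b′
build-injective []       []       []         []         _  = refl , refl
build-injective (c ∷ cs) (b ∷ bs) (c′ ∷ cs′) (b′ ∷ bs′) eq
  with deq , eq′ ← replicate-++-injective (digit c b) (digit c′ b′) (All.map s≤s (build≤ cs bs)) (All.map s≤s (build≤ cs′ bs′)) eq
  with refl , refl ← digit-injective c b c′ b′ deq
  with refl , refl ← build-injective cs bs cs′ bs′ eq′ = refl , refl

-- In a weakly decreasing list the copies of the largest admissible value L + 1 come first, and the
-- first smaller entry bounds the rest.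
peel : ∀ L {xs} → Linked _≥_ xs → All (_≤ suc L) xs →
       ∃₂ λ a ys → xs ≡ replicate a (suc L) ++ ys × All (_≤ L) ys × Linked _≥_ ys
peel L {[]}     []  []       = 0 , [] , refl , [] , []
peel L {x ∷ xs} lk (x≤ ∷ xs≤) with x ≟ suc L
... | no x≢ = 0 , x ∷ xs , refl , Linked.Linked⇒All (λ p q → ≤-trans q p) (s≤s⁻¹ (≤∧≢⇒< x≤ x≢)) lk , lk
... | yes refl with a , ys , refl , ys≤ , lk′ ← peel L (Linked.tail lk) xs≤ = suc a , ys , refl , ys≤ , lk′

digit-surjective : ∀ {a} → a ≤ 3 → ∃₂ λ c b → digit c b ≡ a
digit-surjective {0} _ = false , false , refl
digit-surjective {1} _ = false , true , refl
digit-surjective {2} _ = true , false , refl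
digit-surjective {3} _ = true , true , refl
digit-surjective {suc (suc (suc (suc _)))} (s≤s (s≤s (s≤s ())))

simplyPaired-top : ∀ a {m ys} → All (_< m) ys → SimplyPaired (replicate a m ++ ys) → a ≤ 3
simplyPaired-top zero    _    _       = z≤n
simplyPaired-top (suc a) ys<m (p ∷ _) = subst (_≤ 3) (multiplicity-top (suc a) ys<m) p

build-surjective : ∀ L {xs} → All (0 <_) xs → Linked _≥_ xs → All (_≤ L) xs → SimplyPaired xs →
                   ∃₂ λ (c b : Vec Bool L) → build c b ≡ xs
build-surjective zero    []        _  _         _  = [] , [] , refl
build-surjective zero    (0<x ∷ _) _  (x≤0 ∷ _) _  = contradiction x≤0 (<⇒≱ 0<x)
build-surjective (suc L) pos       lk xs≤       sp with peel L lk xs≤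
... | a , ys , refl , ys≤ , lk′
  with cs , bs , refl ← build-surjective L (All.++⁻ʳ (replicate a (suc L)) pos) lk′ ys≤
         (All.zipWith (λ (k≤L , μ≤3) → subst (_≤ 3) (multiplicity-below a ys (s≤s k≤L)) μ≤3)
           (ys≤ , All.++⁻ʳ (replicate a (suc L)) sp))
  with c , b , refl ← digit-surjective {a} (simplyPaired-top a (All.map s≤s ys≤) sp) = c ∷ cs , b ∷ bs , refl

-- Summing over the alternating sum

negativePairs : ∀ n → Finite (λ ((c , b) : Vec Bool n × Vec Bool n) → top c < alt b × weight b + 2 * weight c ≡ n)
negativePairs n = finite
  (λ (c , b) → top c <? alt b ×-dec weight b + 2 * weight c ≟ n)
  (cartesianProduct (allWords n) (allWords n))
  (Unique.cartesianProduct⁺ (allWords-unique n) (allWords-unique n))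
  (λ _ → ∈-cartesianProduct⁺ (∈-allWords _) (∈-allWords _))

M≡negativePairs : ∀ n → M n ≡ card (negativePairs n)
M≡negativePairs n = sym (card-bij (negativePairs n) (negativeSimplyPaired n)
  (λ (c , b) → build c b)
  (λ {(c , b)} {(c′ , b′)} eq → let c≡ , b≡ = build-injective c b c′ b′ eq in cong₂ _,_ c≡ b≡)
  (λ {(c , b)} (t<a , w) → (build-positive c b , build-linked c b , trans (build-sum c b) w) , build-simplyPaired c b ,
     subst (ℤ._< ℤ.0ℤ) (sym (build-ρ c b)) (<⇒negative t<a))
  from)
  where
  negative : ∀ c b → IsNegativeSimplyPaired n (build c b) → top c < alt b × weight b + 2 * weight c ≡ n
  negative c b ((_ , _ , total) , _ , ρ<0) =
    negative⇒< (subst (ℤ._< ℤ.0ℤ) (build-ρ c b) ρ<0) , trans (sym (build-sum c b)) total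
  from : ∀ {xs} → IsNegativeSimplyPaired n xs → _
  from {xs} p@((pos , lk , total) , sp , _)
    -- Words of length `n` are long enough because each part is at most the sum `n`.
    with c , b , eq ← build-surjective n pos lk
           (subst (λ m → All (_≤ m) xs) (trans (cong sum (map-id xs)) total) (parts≤sum id xs)) sp =
    (c , b) , negative c b (subst (IsNegativeSimplyPaired n) (sym eq) p) , eq

M-Σ : ∀ n → M (suc n) ≡ Σ< (suc n) (λ k → G k (suc n))
M-Σ n = begin
  M (suc n)
    ≡⟨ M≡negativePairs (suc n) ⟩
  card (negativePairs (suc n))
    ≡⟨ card-fibres (negativePairs (suc n)) (λ (c , b) → alt b) (2 + n) (λ {(c , b)} _ → s≤s (alt≤ b)) ⟩
  Σ< (2 + n) fibre
    ≡⟨ Σ<-suc (suc n) fibre ⟩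
  fibre 0 + Σ< (suc n) (fibre ∘ suc)
    -- Alternating sum 0 is impossible, since it would have to exceed `top c`.
    ≡⟨ cong₂ _+_ (card-empty (fibreF 0) (λ ((t , _) , a) → n≮0 (<-≤-trans t (≤-reflexive a)))) (Σ<-cong (suc n) step) ⟩
  Σ< (suc n) (λ k → G k (suc n)) ∎
  where
  open ≡-Reasoning
  fibreF = λ k → restrict (negativePairs (suc n)) (λ (c , b) → alt b ≟ k)
  fibre : ℕ → ℕ
  fibre k = card (fibreF k)
  step : ∀ k → k < suc n → fibre (suc k) ≡ G k (suc n)
  step k k<1+n = begin
    fibre (suc k)
      ≡⟨ card-cong (fibreF (suc k)) (pairs (suc n) (suc n) (suc k) (suc k) (suc n))
           (λ { ((t , w) , a) → <-≤-trans t (≤-reflexive a) , a , w }) (λ { (t , a , w) → (<-≤-trans t (≤-reflexive (sym a)) , w) , a }) ⟩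
    card (pairs (suc n) (suc n) (suc k) (suc k) (suc n))
      -- The length is split as (n + 1 - k) + k so that `card-pairs` applies.
      ≡⟨ cong (λ L → card (pairs L (suc n) (suc k) (suc k) (suc n))) (m∸n+n≡m (<⇒≤ k<1+n)) ⟨
    card (pairs (suc n ∸ k + k) (suc n) (suc k) (suc k) (suc n))
      ≡⟨ card-pairs (suc n ∸ k) (suc n) k (suc k) (suc n) ⟩
    E k (d (suc n) (suc k)) (suc n)
      -- Coefficients up to n + 1 are unaffected by the bound n + 1 on the elements.
      ≡⟨ E-cong≤ k (suc n) (λ m → d-stable) ⟩
    G k (suc n) ∎

theorem6p3 : (n : ℕ) → 1 ≤ n → 2 * M n ≡ p̄odd n
theorem6p3 (suc n) _ = begin
  2 * M (suc n)
    ≡⟨ cong (M (suc n) +_) (+-identityʳ (M (suc n))) ⟩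
  M (suc n) + M (suc n)
    ≡⟨ cong₂ _+_ (M-Σ n) (M-Σ n) ⟩
  Σ< (suc n) (λ k → G k (suc n)) + Σ< (suc n) (λ k → G k (suc n))
    ≡⟨ Σ<-⊕ (suc n) _ _ ⟨
  Σ< (suc n) (λ k → G k (suc n) + G k (suc n))
    ≡⟨ Σ<-cong (suc n) (λ k _ → h≗G⊕G k (suc n)) ⟨
  Σ< (suc n) (λ k → h (suc k) (suc n))
    ≡⟨ p̄odd-Σ n ⟨
  p̄odd (suc n) ∎
  where open ≡-Reasoning
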